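{- Let $S$ be a specular set on the finite alphabet $A$ relative to the involution $\theta$. Then $S$ is orientable if and only if there is a partition $A=A_+\cup A_-$ of the alphabet $A$ and a tree set $T$ of characteristic $1$ on the alphabet $A_+$ such that $S=T\cup T^{ -1}$, where $T^{ -1}=\{x^{ -1}\mid x\in T\}$.
   Context: Words are over a finite alphabet $A$; $\varepsilon$ is the empty word. A set $S$ of words on $A$ is factorial if it contains $A$ and all the factors of its elements (factorial sets of words over a sub-alphabet are understood with respect to that sub-alphabet). For $w\in S$ let $L(w)=\{a\in A\mid aw\in S\}$, $R(w)=\{a\in A\mid wa\in S\}$, $B(w)=\{(a,b)\in A\times A\mid awb\in S\}$. A factorial set $S$ is biextendable if $B(w)\neq\emptyset$ for all $w\in S$. The extension graph $\mathcal{E}(w)$ is the undirected graph whose vertex set is the disjoint union of $L(w)$ and $R(w)$ and whose edges are the pairs in $B(w)$. A biextendable set $S$ is a tree set of characteristic $c$ if $\mathcal{E}(w)$ is a tree for every nonempty $w\in S$ and $\mathcal{E}(\varepsilon)$ is a disjoint union of $c$ trees. Let $\theta$ be an involution on $A$ (possibly with fixed points) and let $G_\theta$ be the group generated by $A$ with relations $a\theta(a)=1$, $a\in A$ (so $a^{ -1}=\theta(a)$). A word is reduced if it has no factor $a\theta(a)$ with $a\in A$; the inverse $x^{ -1}$ in $G_\theta$ of a reduced word $x=a_1\cdots a_n$ is the reduced word $\theta(a_n)\cdots\theta(a_1)$. A laminary set on $A$ relative to $\theta$ is a biextendable set of reduced words closed under taking inverses. A specular set is a laminary set which is a tree set of characteristic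 $2$. A laminary set $S$ is orientable if there exist two sets $S_+,S_-$, each closed under taking factors, such that $S=S_+\cup S_-$, $S_+\cap S_-=\{\varepsilon\}$, and for any $x\in S$ one has $x\in S_-$ if and only if $x^{ -1}\in S_+$. -}

module Defs where

open import Data.Empty using (⊥)
open import Data.Fin.Base using (Fin)
open import Data.List.Base using (List; []; _∷_; [_]; _∷ʳ_; length; map; reverse)
open import Data.List.Relation.Binary.Infix.Heterogeneous using (Infix; here; there)
open import Data.List.Relation.Binary.Prefix.Heterogeneous using (Prefix; []; _∷_)
open import Data.List.Relation.Unary.All using (All)
open import Data.List.Relation.Unary.Linked using (Linked)
open import Data.List.Relation.Unary.Unique.Propositional using (Unique)
open import Data.Nat.Base using (ℕ; _≤_)
open import Data.Product.Base using (∃-syntax; _×_; _,_)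
open import Data.Sum.Base using (_⊎_; inj₁; inj₂)
open import Function.Bundles using (_⇔_)
open import Level using (0ℓ)
open import Relation.Binary.Construct.Closure.ReflexiveTransitive using (Star)
open import Relation.Binary.Core using (Rel)
open import Relation.Binary.Definitions using (Symmetric)
open import Relation.Binary.PropositionalEquality using (_≡_; _≢_; refl)
open import Relation.Nullary.Negation using (¬_)
open import Relation.Unary using (Pred; _∈_; _⊆_; _≐_; _∪_; _∩_; ∅; ｛_｝; U; Satisfiable; Universal)

-- A simple undirected graph whose vertex set is a subset of the type X.
record Graph (X : Set) : Set₁ where
  field
    Vertex  : Pred X 0ℓ
    _~_     : Rel X 0ℓ
    ends    : ∀ {u v} → u ~ v → u ∈ Vertex × v ∈ Vertex
    ~-sym   : Symmetric _~_
    ~-irr   : ∀ {v} → ¬ (v ~ v)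

module _ {X : Set} (G : Graph X) where
  open Graph G

  induced : Pred X 0ℓ → Graph X
  induced P = record
    { Vertex  = Vertex ∩ P
    ; _~_     = λ u v → u ∈ P × v ∈ P × u ~ v
    ; ends    = λ { (pu , pv , e) → let (u∈ , v∈) = ends e in (u∈ , pu) , (v∈ , pv) }
    ; ~-sym   = λ { (pu , pv , e) → pv , pu , ~-sym e }
    ; ~-irr   = λ { (_ , _ , e) → ~-irr e }
    }

  -- The cycle v, v₁, …, vₖ, v with k ≥ 2 and v, v₁, …, vₖ pairwise distinct.
  record Cycle : Set where
    field
      base     : X
      others   : List X
      long     : 2 ≤ length others
      distinct : Unique (base ∷ others)
      closed   : Linked _~_ (base ∷ others ∷ʳ base)

  record IsTree : Set where
    field
      nonempty  : Satisfiable Vertex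
      connected : ∀ {u v} → u ∈ Vertex → v ∈ Vertex → Star _~_ u v
      acyclic   : ¬ Cycle

record IsDisjointUnionOfTrees {X : Set} (c : ℕ) (G : Graph X) : Set₁ where
  open Graph G
  field
    part     : Fin c → Pred X 0ℓ
    cover    : Vertex ≐ (λ v → ∃[ i ] v ∈ part i)
    disjoint : ∀ {i j v} → v ∈ part i → v ∈ part j → i ≡ j
    no-cross : ∀ {i u v} → u ~ v → u ∈ part i → v ∈ part i
    trees    : ∀ i → IsTree (induced G (part i))

module _ {A : Set} where

  Word : Set
  Word = List A

  _IsFactorOf_ : Word → Word → Set
  _IsFactorOf_ = Infix _≡_

  FactorClosed : Pred Word 0ℓ → Set
  FactorClosed S = ∀ {u w} → u IsFactorOf w → w ∈ S → u ∈ S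

  -- Here and below, B ⊆ A is the alphabet on which S is considered (B = U for
  -- the whole of A).
  record IsFactorial (B : Pred A 0ℓ) (S : Pred Word 0ℓ) : Set where
    field
      words   : S ⊆ All B
      letters : ∀ {a} → a ∈ B → [ a ] ∈ S
      factors : FactorClosed S

  module Extensions (B : Pred A 0ℓ) (S : Pred Word 0ℓ) where

    L : Word → Pred A 0ℓ
    L w a = a ∈ B × (a ∷ w) ∈ S

    R : Word → Pred A 0ℓ
    R w a = a ∈ B × (w ∷ʳ a) ∈ S

    BiExt : Word → Pred (A × A) 0ℓ
    BiExt w (a , b) = (a ∈ B × b ∈ B) × (a ∷ w ∷ʳ b) ∈ S

    -- The disjoint union of L(w) and R(w) lives in A ⊎ A: inj₁ a is a as an
    -- element of L(w), inj₂ b is b as an element of R(w).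
    ExtVertex : Word → Pred (A ⊎ A) 0ℓ
    ExtVertex w (inj₁ a) = a ∈ L w
    ExtVertex w (inj₂ b) = b ∈ R w

    ExtEdge : Word → Rel (A ⊎ A) 0ℓ
    ExtEdge w (inj₁ a) (inj₂ b) = (a , b) ∈ BiExt w
    ExtEdge w (inj₂ b) (inj₁ a) = (a , b) ∈ BiExt w
    ExtEdge w (inj₁ _) (inj₁ _) = ⊥
    ExtEdge w (inj₂ _) (inj₂ _) = ⊥

  open Extensions

  record IsBiextendable (B : Pred A 0ℓ) (S : Pred Word 0ℓ) : Set where
    field
      factorial  : IsFactorial B S
      extendable : ∀ {w} → w ∈ S → Satisfiable (BiExt B S w)

  module _ {B : Pred A 0ℓ} {S : Pred Word 0ℓ} (fac : IsFactorial B S) (w : Word) where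
    open IsFactorial fac

    private
      prefix-∷ʳ : (v : Word) {b : A} → Prefix _≡_ v (v ∷ʳ b)
      prefix-∷ʳ []      = []
      prefix-∷ʳ (_ ∷ v) = refl ∷ prefix-∷ʳ v

      prefix-refl : (v : Word) → Prefix _≡_ v v
      prefix-refl []      = []
      prefix-refl (_ ∷ v) = refl ∷ prefix-refl v

      left : ∀ {a b} → (a , b) ∈ BiExt B S w → a ∈ L B S w
      left ((a∈ , _) , awb) = a∈ , factors (here (prefix-∷ʳ (_ ∷ w))) awb

      right : ∀ {a b} → (a , b) ∈ BiExt B S w → b ∈ R B S w
      right ((_ , b∈) , awb) = b∈ , factors (there (here (prefix-refl (w ∷ʳ _)))) awb

      ext-ends : ∀ u v → ExtEdge B S w u v → u ∈ ExtVertex B S w × v ∈ ExtVertex B S w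
      ext-ends (inj₁ _) (inj₂ _) e = left e , right e
      ext-ends (inj₂ _) (inj₁ _) e = right e , left e

      ext-sym : ∀ u v → ExtEdge B S w u v → ExtEdge B S w v u
      ext-sym (inj₁ _) (inj₂ _) e = e
      ext-sym (inj₂ _) (inj₁ _) e = e

      ext-irrefl : ∀ v → ¬ ExtEdge B S w v v
      ext-irrefl (inj₁ _) ()
      ext-irrefl (inj₂ _) ()

    extensionGraph : Graph (A ⊎ A)
    extensionGraph = record
      { Vertex  = ExtVertex B S w
      ; _~_     = ExtEdge B S w
      ; ends    = λ {u} {v} → ext-ends u v
      ; ~-sym   = λ {u} {v} → ext-sym u v
      ; ~-irr   = λ {v} → ext-irrefl v
      }

  record IsTreeSet (B : Pred A 0ℓ) (c : ℕ) (S : Pred Word 0ℓ) : Set₁ where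
    field
      biextendable : IsBiextendable B S
    open IsBiextendable biextendable public
    field
      tree   : ∀ {w} → w ∈ S → w ≢ [] → IsTree (extensionGraph factorial w)
      forest : IsDisjointUnionOfTrees c (extensionGraph factorial [])

  record IsPartition (A₊ A₋ : Pred A 0ℓ) : Set where
    field
      nonempty₊ : Satisfiable A₊
      nonempty₋ : Satisfiable A₋
      cover     : Universal (A₊ ∪ A₋)
      disjoint  : A₊ ∩ A₋ ⊆ ∅

  module _ (θ : A → A) where

    IsReduced : Pred Word 0ℓ
    IsReduced w = ∀ a → ¬ ((a ∷ θ a ∷ []) IsFactorOf w)

    -- For a reduced word this is the reduced word representing its inverse in
    -- the group G_θ = ⟨ A ∣ a θ(a) = 1 ⟩.
    inverse : Word → Word
    inverse w = reverse (map θ w)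

    inverseSet : Pred Word 0ℓ → Pred Word 0ℓ
    inverseSet T y = ∃[ x ] x ∈ T × y ≡ inverse x

    record IsLaminary (S : Pred Word 0ℓ) : Set where
      field
        biextendable   : IsBiextendable U S
        reduced        : S ⊆ IsReduced
        inverse-closed : ∀ {x} → x ∈ S → inverse x ∈ S

    record IsSpecular (S : Pred Word 0ℓ) : Set₁ where
      field
        laminary : IsLaminary S
        treeSet  : IsTreeSet U 2 S

    record IsOrientable (S : Pred Word 0ℓ) : Set₁ where
      field
        S₊ S₋    : Pred Word 0ℓ
        factors₊ : FactorClosed S₊
        factors₋ : FactorClosed S₋
        union    : S ≐ S₊ ∪ S₋
        meet     : S₊ ∩ S₋ ≐ ｛ [] ｝
        swap     : ∀ {x} → x ∈ S → (x ∈ S₋) ⇔ (inverse x ∈ S₊)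

{-# OPTIONS --safe #-}
-- If S = S₊ ∪ S₋ is an orientation, a word of S with a nonempty factor in S₊
-- lies in S₊.  Hence S and S₊ give the same extension graph for each nonempty
-- word of S₊, and the graph of ε for S₊ is closed under adjacency in the
-- one for S.  The latter has two components, one of which contains negative
-- letters, so the positive vertices form exactly one component.
-- Conversely, if S = T ∪ T⁻¹ and T, T⁻¹ shared a letter, the graph of ε for S
-- would be the union of two connected graphs with a common vertex, hence
-- connected, which contradicts characteristic 2.
module Submission where

open import Defs
open import Algebra.Definitions using (Involutive)
open import Data.Empty using (⊥-elim)
open import Data.Fin.Base using (Fin; zero; suc)
open import Data.List.Base using (List; []; _∷_; [_]; _++_; _∷ʳ_; map; reverse)
open import Data.List.Properties using (map-++; reverse-++; reverse-map; reverse-involutive; map-∘; map-cong; map-id; ++-assoc)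
open import Data.List.Relation.Binary.Infix.Heterogeneous using (here; there; toView; fromView; MkView; _ⁱ++_)
open import Data.List.Relation.Binary.Infix.Heterogeneous.Properties using (fromPointwise)
open import Data.List.Relation.Binary.Pointwise as Pointwise using (Pointwise-≡⇒≡)
open import Data.List.Relation.Binary.Prefix.Heterogeneous using ([]; _∷_)
open import Data.List.Relation.Unary.All as All using (All; []; _∷_)
open import Data.List.Relation.Unary.All.Properties using (∷ʳ⁻)
open import Data.List.Relation.Unary.Linked as Linked using (Linked; [-]; _∷_)
open import Data.Nat.Base using (ℕ)
open import Data.Product.Base using (∃-syntax; _×_; _,_; proj₁; proj₂)
open import Data.Sum.Base as Sum using (_⊎_; inj₁; inj₂)
open import Function.Base using (id; _∘_)
open import Function.Bundles using (_⇔_; _↔_; mk⇔; Equivalence)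
open import Level using (0ℓ)
open import Relation.Binary.Construct.Closure.ReflexiveTransitive as Star using (Star; ε; _◅_; _◅◅_)
open import Relation.Binary.Core using (Rel; _⇒_)
open import Relation.Binary.PropositionalEquality using (_≡_; _≢_; refl; sym; trans; cong; subst; subst₂; module ≡-Reasoning)
open import Relation.Nullary.Negation using (¬_; contradiction)
open import Relation.Unary using (Pred; _∈_; _⊆_; _≐_; _∪_; U)

-- Graphs

module _ {X : Set} where

  -- `P` is an invariant carried along the path. Each step is replaced only after its source is
  -- known to satisfy `P`, so `Q` may be a smaller relation than `R`.
  Star-restrict : {P : Pred X 0ℓ} {R Q : Rel X 0ℓ} →
    (∀ {u v} → u ∈ P → R u v → Q u v × v ∈ P) →
    ∀ {u v} → u ∈ P → Star R u v → Star Q u v × v ∈ P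
  Star-restrict f u∈P ε = ε , u∈P
  Star-restrict f u∈P (e ◅ es) =
    let (e′ , w∈P)  = f u∈P e
        (es′ , v∈P) = Star-restrict f w∈P es
    in e′ ◅ es′ , v∈P

  Linked-restrict : {P : Pred X 0ℓ} {R : Rel X 0ℓ} →
    (∀ {u v} → R u v → u ∈ P → v ∈ P) →
    ∀ {u us} → u ∈ P → Linked R (u ∷ us) → Linked (λ x y → x ∈ P × y ∈ P × R x y) (u ∷ us)
  Linked-restrict f u∈P [-]      = [-]
  Linked-restrict f u∈P (e ∷ es) = (u∈P , f e u∈P , e) ∷ Linked-restrict f (f e u∈P) es

  Cycle-map : {G H : Graph X} → Graph._~_ G ⇒ Graph._~_ H → Cycle G → Cycle H
  Cycle-map f c = record
    { base = base ; others = others ; long = long ; distinct = distinct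
    ; closed = Linked.map f closed }
    where open Cycle c

  module _ {G H : Graph X} where
    private
      module G = Graph G
      module H = Graph H

    IsTree-resp : G.Vertex ≐ H.Vertex → G._~_ ⇒ H._~_ → H._~_ ⇒ G._~_ → IsTree G → IsTree H
    IsTree-resp (to , from) f g t = record
      { nonempty  = let (v , v∈) = nonempty in v , to v∈
      ; connected = λ u∈ v∈ → Star.map f (connected (from u∈) (from v∈))
      ; acyclic   = acyclic ∘ Cycle-map {H} {G} g
      }
      where open IsTree t

  module _ {c : ℕ} {G : Graph X} (F : IsDisjointUnionOfTrees c G) where
    open Graph G
    open IsDisjointUnionOfTrees F

    part-connected : ∀ {i u v} → u ∈ part i → v ∈ part i → Star _~_ u v
    part-connected {i} u∈ v∈ = Star.map (proj₂ ∘ proj₂)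
      (IsTree.connected (trees i) (proj₂ cover (i , u∈) , u∈) (proj₂ cover (i , v∈) , v∈))

    -- By `no-cross` a cycle never leaves the part of its base, so it is already a cycle of the tree
    -- induced on that part.
    forest-acyclic : ¬ Cycle G
    forest-acyclic record { others = [] ; long = () }
    -- The first edge `e` shows that `b` is a vertex and hence lies in some part.
    forest-acyclic record { base = b ; others = o ∷ os ; long = l ; distinct = d ; closed = e ∷ es } =
      let (i , b∈) = proj₁ cover (proj₁ (ends e)) in
      IsTree.acyclic (trees i) record
        { base = b ; others = o ∷ os ; long = l ; distinct = d
        ; closed = Linked-restrict no-cross b∈ (e ∷ es) }

  IsTree⇒IsDisjointUnionOfTrees : {G : Graph X} → IsTree G → IsDisjointUnionOfTrees 1 G
  IsTree⇒IsDisjointUnionOfTrees {G} t = record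
    { part     = λ _ → Vertex
    ; cover    = (λ v∈ → zero , v∈) , proj₂
    ; disjoint = λ { {zero} {zero} _ _ → refl }
    ; no-cross = λ e _ → proj₂ (ends e)
    ; trees    = λ _ → IsTree-resp {G} {induced G Vertex}
        ((λ v∈ → v∈ , v∈) , proj₁)
        (λ e → proj₁ (ends e) , proj₂ (ends e) , e)
        (proj₂ ∘ proj₂) t
    }
    where open Graph G

  module _ {G : Graph X} (F : IsDisjointUnionOfTrees 1 G) where
    open Graph G
    open IsDisjointUnionOfTrees F

    one-tree-connected : ∀ {u v} → u ∈ Vertex → v ∈ Vertex → Star _~_ u v
    one-tree-connected u∈ v∈ with proj₁ cover u∈ | proj₁ cover v∈
    ... | zero , u∈₀ | zero , v∈₀ = part-connected F u∈₀ v∈₀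

  module _ {G : Graph X} (F : IsDisjointUnionOfTrees 2 G) where
    open Graph G
    open IsDisjointUnionOfTrees F

    -- A path that starts in one part stays there by `no-cross`, while the other part is nonempty
    -- and disjoint from it.
    two-trees-disconnected : ¬ (∀ {u v} → u ∈ Vertex → v ∈ Vertex → Star _~_ u v)
    two-trees-disconnected conn =
      let (x , x∈V , x∈₀) = IsTree.nonempty (trees zero)
          (y , y∈V , y∈₁) = IsTree.nonempty (trees (suc zero))
          (_ , y∈₀)       = Star-restrict (λ p e → e , no-cross e p) x∈₀ (conn x∈V y∈V)
      in contradiction (disjoint y∈₀ y∈₁) λ ()

    two-trees-pigeonhole : ∀ {u v w} → u ∈ Vertex → v ∈ Vertex → w ∈ Vertex →
      Star _~_ u v ⊎ Star _~_ u w ⊎ Star _~_ v w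
    two-trees-pigeonhole u∈ v∈ w∈ with proj₁ cover u∈ | proj₁ cover v∈ | proj₁ cover w∈
    ... | zero     , p | zero     , q | _            = inj₁ (part-connected F p q)
    ... | suc zero , p | suc zero , q | _            = inj₁ (part-connected F p q)
    ... | zero     , p | suc zero , q | zero     , r = inj₂ (inj₁ (part-connected F p r))
    ... | suc zero , p | zero     , q | suc zero , r = inj₂ (inj₁ (part-connected F p r))
    ... | zero     , p | suc zero , q | suc zero , r = inj₂ (inj₂ (part-connected F q r))
    ... | suc zero , p | zero     , q | zero     , r = inj₂ (inj₂ (part-connected F q r))

-- Factors, inverses and extensions

module _ {A : Set} where
  open Extensions

  factor-refl : ∀ {w : List A} → w IsFactorOf w
  factor-refl = fromPointwise (Pointwise.refl refl)

  factor-∷ʳ : ∀ {w : List A} {b} → w IsFactorOf (w ∷ʳ b)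
  factor-∷ʳ = factor-refl ⁱ++ _

  FactorClosed⇒letters : {T : Pred (List A) 0ℓ} → FactorClosed T →
    ∀ {w} → w ∈ T → All (λ a → [ a ] ∈ T) w
  FactorClosed⇒letters fc {[]}    w∈T = []
  FactorClosed⇒letters fc {a ∷ w} w∈T =
    fc (here (refl ∷ [])) w∈T ∷ FactorClosed⇒letters fc (fc (there factor-refl) w∈T)

  FactorClosed⇒ends : {T : Pred (List A) 0ℓ} → FactorClosed T →
    ∀ {a b} w → (a ∷ w ∷ʳ b) ∈ T → [ a ] ∈ T × [ b ] ∈ T
  FactorClosed⇒ends fc w awb∈ with FactorClosed⇒letters fc awb∈
  ... | a∈ ∷ wb∈ = a∈ , proj₂ (∷ʳ⁻ wb∈)

  letter : A ⊎ A → A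
  letter = Sum.reduce

  ExtEdge-map : {B C : Pred A 0ℓ} {S T : Pred (List A) 0ℓ} (w : List A) →
    BiExt B S w ⊆ BiExt C T w → ExtEdge B S w ⇒ ExtEdge C T w
  ExtEdge-map w f {inj₁ _} {inj₂ _} e = f e
  ExtEdge-map w f {inj₂ _} {inj₁ _} e = f e

  module _ {B : Pred A 0ℓ} {S : Pred (List A) 0ℓ} where

    ExtVertex⇒letter : ∀ {w} v → v ∈ ExtVertex B S w → letter v ∈ B
    ExtVertex⇒letter (inj₁ _) = proj₁
    ExtVertex⇒letter (inj₂ _) = proj₁

    letter⇒ExtVertex-[] : IsFactorial B S → ∀ v → letter v ∈ B → v ∈ ExtVertex B S []
    letter⇒ExtVertex-[] fac (inj₁ _) a∈ = a∈ , IsFactorial.letters fac a∈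
    letter⇒ExtVertex-[] fac (inj₂ _) a∈ = a∈ , IsFactorial.letters fac a∈

  module _ (θ : A → A) where

    inverse-++ : ∀ x y → inverse θ (x ++ y) ≡ inverse θ y ++ inverse θ x
    inverse-++ x y = trans (cong reverse (map-++ θ x y)) (reverse-++ (map θ x) (map θ y))

    inverse-++-++ : ∀ x y z → inverse θ (x ++ y ++ z) ≡ inverse θ z ++ inverse θ y ++ inverse θ x
    inverse-++-++ x y z = begin
      inverse θ (x ++ y ++ z)                     ≡⟨ inverse-++ x (y ++ z) ⟩
      inverse θ (y ++ z) ++ inverse θ x           ≡⟨ cong (_++ inverse θ x) (inverse-++ y z) ⟩
      (inverse θ z ++ inverse θ y) ++ inverse θ x ≡⟨ ++-assoc (inverse θ z) _ _ ⟩
      inverse θ z ++ inverse θ y ++ inverse θ x   ∎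
      where open ≡-Reasoning

    -- In `w = p u s` inversion reverses the order of the three blocks, so the inverse of `u` sits
    -- between those of `s` and `p`.
    inverse-factor : ∀ {u w} → u IsFactorOf w → inverse θ u IsFactorOf inverse θ w
    inverse-factor {u} u⊑w with toView u⊑w
    ... | MkView p u≋v s with refl ← Pointwise-≡⇒≡ u≋v =
      subst (inverse θ u IsFactorOf_) (sym (inverse-++-++ p u s))
        (fromView (MkView (inverse θ s) (Pointwise.refl refl) (inverse θ p)))

    module _ (θ-inv : Involutive _≡_ θ) where

      inverse-involutive : Involutive _≡_ (inverse θ)
      inverse-involutive w = begin
        reverse (map θ (reverse (map θ w))) ≡⟨ cong reverse (reverse-map θ (map θ w)) ⟩
        reverse (reverse (map θ (map θ w))) ≡⟨ reverse-involutive _ ⟩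
        map θ (map θ w)                     ≡⟨ map-∘ w ⟨
        map (θ ∘ θ) w                       ≡⟨ map-cong θ-inv w ⟩
        map id w                            ≡⟨ map-id w ⟩
        w                                   ∎
        where open ≡-Reasoning

      -- With its converse below, this replaces the existential in `inverseSet` by a test on the
      -- inverse, since inversion is its own inverse.
      inverseSet-∈ : {T : Pred (List A) 0ℓ} → ∀ {x} → inverse θ x ∈ T → x ∈ inverseSet θ T
      inverseSet-∈ {x = x} x⁻¹∈ = inverse θ x , x⁻¹∈ , sym (inverse-involutive x)

      inverseSet-∋ : {T : Pred (List A) 0ℓ} → ∀ {x} → x ∈ inverseSet θ T → inverse θ x ∈ T
      inverseSet-∋ {T} (y , y∈ , refl) = subst T (sym (inverse-involutive y)) y∈

      FactorClosed-inverseSet : {T : Pred (List A) 0ℓ} → FactorClosed T → FactorClosed (inverseSet θ T)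
      FactorClosed-inverseSet {T} fc u⊑w w∈ =
        inverseSet-∈ {T} (fc (inverse-factor u⊑w) (inverseSet-∋ {T} w∈))

module _ {A : Set} {θ : A → A} (θ-inv : Involutive _≡_ θ)
         {S : Pred (List A) 0ℓ} (specular : IsSpecular θ S) where
  open Extensions
  open IsSpecular specular
  open IsLaminary laminary using (inverse-closed)
  open IsTreeSet treeSet

  private
    module S = IsFactorial factorial

  -- From an orientation to a tree set on the positive letters

  module Orientable⇒Split (orientable : IsOrientable θ S) where
    open IsOrientable orientable

    A₊ A₋ : Pred A 0ℓ
    A₊ a = [ a ] ∈ S₊
    A₋ a = [ a ] ∈ S₋

    S₊⊆S : S₊ ⊆ S
    S₊⊆S x∈ = proj₂ union (inj₁ x∈)

    -- If `v` were in `S₋`, so would be its factor `u`, which would then lie in both halves and be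
    -- empty.
    S₊-extends : ∀ {u v} → u ≢ [] → u ∈ S₊ → u IsFactorOf v → v ∈ S → v ∈ S₊
    S₊-extends u≢[] u∈ u⊑v v∈ with proj₁ union v∈
    ... | inj₁ v∈₊ = v∈₊
    ... | inj₂ v∈₋ = contradiction (sym (proj₁ meet (u∈ , factors₋ u⊑v v∈₋))) u≢[]

    A₊∩A₋ : ∀ {a} → a ∈ A₊ → ¬ a ∈ A₋
    A₊∩A₋ a∈₊ a∈₋ with proj₁ meet (a∈₊ , a∈₋)
    ... | ()

    A₊∪A₋ : ∀ a → a ∈ A₊ ⊎ a ∈ A₋
    A₊∪A₋ a = proj₁ union (S.letters _)

    -- This is `swap` at the word `[ θ a ]`, whose inverse is `[ θ (θ a) ]`.
    θ-A₊ : ∀ {a} → a ∈ A₊ → θ a ∈ A₋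
    θ-A₊ {a} a∈ = Equivalence.from (swap (S.letters _)) (subst A₊ (sym (θ-inv a)) a∈)

    θ-A₋ : ∀ {a} → a ∈ A₋ → θ a ∈ A₊
    θ-A₋ = Equivalence.to (swap (S.letters _))

    -- A tree of the forest has a vertex, so some letter exists; `θ` supplies one of the opposite
    -- sign.
    letters-of-both-signs : (∃[ a ] a ∈ A₊) × (∃[ a ] a ∈ A₋)
    letters-of-both-signs with IsTree.nonempty (IsDisjointUnionOfTrees.trees forest zero)
    ... | v , _ with A₊∪A₋ (letter v)
    ...   | inj₁ a∈ = (letter v , a∈) , (θ (letter v) , θ-A₊ a∈)
    ...   | inj₂ a∈ = (θ (letter v) , θ-A₋ a∈) , (letter v , a∈)

    partition : IsPartition A₊ A₋
    partition = record
      { nonempty₊ = proj₁ letters-of-both-signs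
      ; nonempty₋ = proj₂ letters-of-both-signs
      ; cover     = A₊∪A₋
      ; disjoint  = λ (a∈₊ , a∈₋) → A₊∩A₋ a∈₊ a∈₋
      }

    factorial₊ : IsFactorial A₊ S₊
    factorial₊ = record
      { words   = FactorClosed⇒letters factors₊
      ; letters = id
      ; factors = factors₊
      }

    BiExt₊ : ∀ w {a b} → (a ∷ w ∷ʳ b) ∈ S₊ → (a , b) ∈ BiExt A₊ S₊ w
    BiExt₊ w awb∈ = FactorClosed⇒ends factors₊ w awb∈ , awb∈

    BiExt₊⊆BiExt : ∀ w → BiExt A₊ S₊ w ⊆ BiExt U S w
    BiExt₊⊆BiExt w (_ , awb∈) = _ , S₊⊆S awb∈

    BiExt⊆BiExt₊ : ∀ {w} → w ≢ [] → w ∈ S₊ → BiExt U S w ⊆ BiExt A₊ S₊ w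
    BiExt⊆BiExt₊ {w} w≢[] w∈ (_ , awb∈) =
      BiExt₊ w (S₊-extends w≢[] w∈ (there factor-∷ʳ) awb∈)

    extendable₊-≢[] : ∀ {w} → w ≢ [] → w ∈ S₊ → ∃[ ab ] ab ∈ BiExt A₊ S₊ w
    extendable₊-≢[] w≢[] w∈ =
      let (ab , ab∈) = extendable (S₊⊆S w∈) in ab , BiExt⊆BiExt₊ w≢[] w∈ ab∈

    extendable₊ : ∀ {w} → w ∈ S₊ → ∃[ ab ] ab ∈ BiExt A₊ S₊ w
    -- The extension of the empty word in `S` may be negative. Instead a positive letter `a` is
    -- extended to `bac`, and its factor `ba` is positive.
    extendable₊ {[]} _ =
      let (a , a∈)           = proj₁ letters-of-both-signs
          ((b , _) , _ , bac∈) = extendable₊-≢[] (λ ()) a∈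
      in (b , a) , BiExt₊ [] (factors₊ (here (refl ∷ refl ∷ [])) bac∈)
    extendable₊ {_ ∷ _} w∈ = extendable₊-≢[] (λ ()) w∈

    ExtVertex⊆ExtVertex₊ : ∀ {w} → w ≢ [] → w ∈ S₊ → ExtVertex U S w ⊆ ExtVertex A₊ S₊ w
    ExtVertex⊆ExtVertex₊ {w} w≢[] w∈ {inj₁ a} (_ , aw∈) =
      let aw∈₊ = S₊-extends w≢[] w∈ (there factor-refl) aw∈
      in All.head (FactorClosed⇒letters factors₊ aw∈₊) , aw∈₊
    ExtVertex⊆ExtVertex₊ {w} w≢[] w∈ {inj₂ b} (_ , wb∈) =
      let wb∈₊ = S₊-extends w≢[] w∈ factor-∷ʳ wb∈
      in proj₂ (∷ʳ⁻ (FactorClosed⇒letters factors₊ wb∈₊)) , wb∈₊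

    ExtVertex₊⊆ExtVertex : ∀ {w} → ExtVertex A₊ S₊ w ⊆ ExtVertex U S w
    ExtVertex₊⊆ExtVertex {w} {inj₁ _} (_ , aw∈) = _ , S₊⊆S aw∈
    ExtVertex₊⊆ExtVertex {w} {inj₂ _} (_ , wb∈) = _ , S₊⊆S wb∈

    tree₊ : ∀ {w} → w ∈ S₊ → w ≢ [] → IsTree (extensionGraph factorial₊ w)
    tree₊ {w} w∈ w≢[] = IsTree-resp
      {G = extensionGraph factorial w} {H = extensionGraph factorial₊ w}
      ( (λ {v} → ExtVertex⊆ExtVertex₊ w≢[] w∈ {v})
      , (λ {v} → ExtVertex₊⊆ExtVertex {w} {v}) )
      (λ {u} {v} → ExtEdge-map w (BiExt⊆BiExt₊ w≢[] w∈) {u} {v})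
      (λ {u} {v} → ExtEdge-map w (BiExt₊⊆BiExt w) {u} {v})
      (tree (S₊⊆S w∈) w≢[])

    -- An edge is a two-letter word of `S`; one positive letter makes the whole word positive, hence
    -- the other letter too.
    ε-edge₊ : ∀ {u v} → letter u ∈ A₊ → ExtEdge U S [] u v →
      ExtEdge A₊ S₊ [] u v × letter v ∈ A₊
    ε-edge₊ {inj₁ a} {inj₂ b} a∈ (_ , ab∈) =
      let e = BiExt₊ [] (S₊-extends (λ ()) a∈ (here (refl ∷ [])) ab∈)
      in e , proj₂ (proj₁ e)
    ε-edge₊ {inj₂ b} {inj₁ a} b∈ (_ , ab∈) =
      let e = BiExt₊ [] (S₊-extends (λ ()) b∈ (there factor-refl) ab∈)
      in e , proj₁ (proj₁ e)

    ε-path₊ : ∀ {u v} → letter u ∈ A₊ → Star (ExtEdge U S []) u v →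
      Star (ExtEdge A₊ S₊ []) u v × letter v ∈ A₊
    ε-path₊ = Star-restrict λ {u} {v} → ε-edge₊ {u} {v}

    ε-connected₊ : ∀ {u v} → u ∈ ExtVertex A₊ S₊ [] → v ∈ ExtVertex A₊ S₊ [] →
      Star (ExtEdge A₊ S₊ []) u v
    ε-connected₊ {u} {v} u∈ v∈
      with (x , x∈₋) ← proj₂ letters-of-both-signs
      -- Two of `u`, `v` and the negative `inj₁ x` share a component. Paths from a positive vertex
      -- stay positive, so only `u` and `v` can.
      with two-trees-pigeonhole forest {u} {v} {inj₁ x}
             (ExtVertex₊⊆ExtVertex {[]} {u} u∈) (ExtVertex₊⊆ExtVertex {[]} {v} v∈)
             (letter⇒ExtVertex-[] factorial (inj₁ x) _)
    ... | inj₁ uv        = proj₁ (ε-path₊ (ExtVertex⇒letter u u∈) uv)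
    ... | inj₂ (inj₁ ux) = ⊥-elim (A₊∩A₋ (proj₂ (ε-path₊ (ExtVertex⇒letter u u∈) ux)) x∈₋)
    ... | inj₂ (inj₂ vx) = ⊥-elim (A₊∩A₋ (proj₂ (ε-path₊ (ExtVertex⇒letter v v∈) vx)) x∈₋)

    ε-tree₊ : IsTree (extensionGraph factorial₊ [])
    ε-tree₊ = record
      { nonempty  = let (a , a∈) = proj₁ letters-of-both-signs in inj₁ a , a∈ , a∈
      ; connected = ε-connected₊
      -- The positive graph is a subgraph of a forest.
      ; acyclic   = forest-acyclic forest ∘
          Cycle-map {G = extensionGraph factorial₊ []} {H = extensionGraph factorial []}
            (λ {u} {v} → ExtEdge-map [] (BiExt₊⊆BiExt []) {u} {v})
      }

    treeSet₊ : IsTreeSet A₊ 1 S₊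
    treeSet₊ = record
      { biextendable = record { factorial = factorial₊ ; extendable = extendable₊ }
      ; tree         = tree₊
      ; forest       = IsTree⇒IsDisjointUnionOfTrees ε-tree₊
      }

    split : S ≐ S₊ ∪ inverseSet θ S₊
    split =
      (λ x∈ → Sum.map₂ (inverseSet-∈ θ θ-inv ∘ Equivalence.to (swap x∈)) (proj₁ union x∈)) ,
      Sum.[ S₊⊆S , (λ { (_ , y∈ , refl) → inverse-closed (S₊⊆S y∈) }) ]

  -- From a tree set and its inverse to an orientation

  module Split⇒Orientable {A₊ A₋ : Pred A 0ℓ} {T : Pred (List A) 0ℓ}
    (partition : IsPartition A₊ A₋) (treeSetT : IsTreeSet A₊ 1 T)
    (split : S ≐ T ∪ inverseSet θ T) where

    private
      module T where
        open IsTreeSet treeSetT public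
        open IsFactorial (IsTreeSet.factorial treeSetT) public
      module P = IsPartition partition

    T⊆S : T ⊆ S
    T⊆S x∈ = proj₂ split (inj₁ x∈)

    [a]∈T⇒a∈A₊ : ∀ {a} → [ a ] ∈ T → a ∈ A₊
    [a]∈T⇒a∈A₊ a∈ = All.head (T.words a∈)

    letter-or-inverse∈A₊ : ∀ a → a ∈ A₊ ⊎ θ a ∈ A₊
    letter-or-inverse∈A₊ a = Sum.map [a]∈T⇒a∈A₊ ([a]∈T⇒a∈A₊ ∘ inverseSet-∋ θ θ-inv {T})
      (proj₁ split (S.letters {a} _))

    -- Inversion turns left extensions into right extensions.
    dual : A ⊎ A → A ⊎ A
    dual (inj₁ a) = inj₂ (θ a)
    dual (inj₂ b) = inj₁ (θ b)

    dual-involutive : Involutive _≡_ dual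
    dual-involutive (inj₁ a) = cong inj₁ (θ-inv a)
    dual-involutive (inj₂ b) = cong inj₂ (θ-inv b)

    letter-dual : ∀ v → letter (dual v) ≡ θ (letter v)
    letter-dual (inj₁ _) = refl
    letter-dual (inj₂ _) = refl

    T-edge⇒S-edge : ExtEdge A₊ T [] ⇒ ExtEdge U S []
    T-edge⇒S-edge {u} {v} = ExtEdge-map [] (λ (_ , ab∈) → _ , T⊆S ab∈) {u} {v}

    -- The word `ab` of `T` has inverse `θ(b)θ(a)` in `S`, so `dual` embeds the graph of the empty
    -- word for `T` into the one for `S` a second time.
    T-edge⇒S-edge-dual : ∀ {u v} → ExtEdge A₊ T [] u v → ExtEdge U S [] (dual u) (dual v)
    T-edge⇒S-edge-dual {inj₁ _} {inj₂ _} (_ , ab∈) = _ , inverse-closed (T⊆S ab∈)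
    T-edge⇒S-edge-dual {inj₂ _} {inj₁ _} (_ , ab∈) = _ , inverse-closed (T⊆S ab∈)

    T-connected : ∀ {u v} → letter u ∈ A₊ → letter v ∈ A₊ → Star (ExtEdge A₊ T []) u v
    T-connected {u} {v} u∈ v∈ = one-tree-connected T.forest
      (letter⇒ExtVertex-[] T.factorial u u∈) (letter⇒ExtVertex-[] T.factorial v v∈)

    -- If `a` and `θ a` were both in `A₊`, the vertex `inj₁ a` would lie in the graph for `T` and in
    -- its image under `dual`. Both are connected and together they cover all vertices, so the graph
    -- for `S` would be connected.
    θ-A₊-disjoint : ∀ {a} → a ∈ A₊ → ¬ θ a ∈ A₊
    θ-A₊-disjoint {a} a∈ θa∈ = two-trees-disconnected forest λ {u} {v} _ _ →
      Star.reverse (λ {u} {v} → Graph.~-sym (extensionGraph factorial []) {u} {v}) (reach u) ◅◅ reach v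
      where
      reach : ∀ v → Star (ExtEdge U S []) (inj₁ a) v
      reach v with letter-or-inverse∈A₊ (letter v)
      ... | inj₁ v∈ = Star.map (λ {u} {v} → T-edge⇒S-edge {u} {v}) (T-connected {inj₁ a} {v} a∈ v∈)
      -- The path is found in the graph for `T` from `dual (inj₁ a)` to `dual v`, and `dual` carries
      -- it back.
      ... | inj₂ v∈ = subst₂ (Star (ExtEdge U S [])) (dual-involutive (inj₁ a)) (dual-involutive v)
        (Star.gmap dual (λ {u} {v} → T-edge⇒S-edge-dual {u} {v})
          (T-connected {inj₂ (θ a)} {dual v} θa∈ (subst A₊ (sym (letter-dual v)) v∈)))

    []∈T : [] ∈ T
    []∈T = T.factors (here []) (T.letters (proj₂ P.nonempty₊))

    -- The first letter `a` of a nonempty common word would itself be common, putting both `a` and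
    -- `θ a` in `A₊`.
    T∩T⁻¹⊆[] : ∀ {x} → x ∈ T → x ∈ inverseSet θ T → [] ≡ x
    T∩T⁻¹⊆[] {[]}    _  _ = refl
    T∩T⁻¹⊆[] {a ∷ x} ax∈ ax∈⁻¹ = ⊥-elim (θ-A₊-disjoint
      ([a]∈T⇒a∈A₊ (T.factors a⊑ax ax∈))
      ([a]∈T⇒a∈A₊ (inverseSet-∋ θ θ-inv {T} (FactorClosed-inverseSet θ θ-inv {T} T.factors a⊑ax ax∈⁻¹))))
      where
      a⊑ax : [ a ] IsFactorOf (a ∷ x)
      a⊑ax = here (refl ∷ [])

    orientable : IsOrientable θ S
    orientable = record
      { S₊       = T
      ; S₋       = inverseSet θ T
      ; factors₊ = T.factors
      ; factors₋ = FactorClosed-inverseSet θ θ-inv {T} T.factors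
      ; union    = split
      ; meet     = (λ (x∈ , x∈⁻¹) → T∩T⁻¹⊆[] x∈ x∈⁻¹) , λ { refl → []∈T , [] , []∈T , refl }
      ; swap     = λ _ → mk⇔ (inverseSet-∋ θ θ-inv {T}) (inverseSet-∈ θ θ-inv {T})
      }

theorem4p4 : {A : Set} (n : ℕ) → A ↔ Fin n →
    (θ : A → A) → Involutive _≡_ θ →
    (S : Pred (List A) 0ℓ) → IsSpecular θ S →
    IsOrientable θ S ⇔
    (∃[ A₊ ] ∃[ A₋ ] ∃[ T ]
    IsPartition {A} A₊ A₋ × IsTreeSet A₊ 1 T × S ≐ T ∪ inverseSet θ T)
theorem4p4 n _ θ θ-inv S specular = mk⇔
  (λ o → let open Orientable⇒Split θ-inv specular o in
    A₊ , A₋ , IsOrientable.S₊ o , partition , treeSet₊ , split)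
  (λ (_ , _ , _ , partition , treeSetT , split) →
    Split⇒Orientable.orientable θ-inv specular partition treeSetT split)
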